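{- Let $\varphi\in\mathrm{For}(\Sigma)$. If $\nvdash_{\mathrm{RmbC}(i2)}\varphi$, then there exist a finite BALFI $\mathbf{A}\in\mathsf{BI}(i2)$ and a valuation $v:\mathrm{For}(\Sigma)\to A$ such that $v(\varphi)\neq 1$.
   Context: $\mathrm{For}(\Sigma)$ is the set of formulas built from a countably infinite set of propositional variables using binary $\wedge,\vee,\to$ and unary $\neg,\circ$; $\alpha\leftrightarrow\beta$ abbreviates $(\alpha\to\beta)\wedge(\beta\to\alpha)$. The logic $\mathrm{RmbC}$ is given by the Hilbert calculus with axiom schemas $\alpha\to(\beta\to\alpha)$; $(\alpha\to(\beta\to\gamma))\to((\alpha\to\beta)\to(\alpha\to\gamma))$; $\alpha\to(\beta\to(\alpha\wedge\beta))$; $(\alpha\wedge\beta)\to\alpha$; $(\alpha\wedge\beta)\to\beta$; $\alpha\to(\alpha\vee\beta)$; $\beta\to(\alpha\vee\beta)$; $(\alpha\to\gamma)\to((\beta\to\gamma)\to((\alpha\vee\beta)\to\gamma))$; $(\alpha\to\beta)\vee\alpha$; $\alpha\vee\neg\alpha$; $\circ\alpha\to(\alpha\to(\neg\alpha\to\beta))$; and inference rules: modus ponens; $(R_\neg)$: from $\alpha\leftrightarrow\psi$ infer $\neg\alpha\leftrightarrow\neg\psi$; $(R_\circ)$: from $\alpha\leftrightarrow\psi$ infer $\circ\alpha\leftrightarrow\circ\psi$. $\mathrm{RmbC}(i2)$ is obtained by adding the axiom schema $(i2)$: $\neg{\circ}\alpha\to\neg\alpha$, and $\vdash_{\mathrm{RmbC}(i2)}\varphi$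 means $\varphi$ is derivable in it (without premises). A BALFI is an algebra $\mathbf{B}=\langle B,\wedge,\vee,\to,\neg,\circ,0,1\rangle$ such that $\langle B,\wedge,\vee,\to,0,1\rangle$ is a Boolean algebra and, for every $a\in B$, $a\vee\neg a=1$ and $a\wedge\neg a\wedge\circ a=0$. A valuation over $\mathbf{B}$ is a homomorphism $v:\mathrm{For}(\Sigma)\to B$. $\mathsf{BI}(i2)$ is the class of BALFIs validating $(i2)$, equivalently satisfying $\neg(\circ a)\wedge\neg a=\neg(\circ a)$ for all $a$. -}

module Defs where

open import Level using (suc; _⊔_)
open import Algebra.Core using (Op₁; Op₂)
open import Algebra.Definitions using (Congruent₁)
open import Algebra.Lattice.Structures using (IsBooleanAlgebra)
open import Data.Fin.Base using (Fin)
open import Data.Nat.Base using (ℕ)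
open import Data.Product.Base using (∃-syntax)
open import Function.Bundles using (Inverse)
open import Relation.Binary.Bundles using (Setoid)
open import Relation.Binary.Core using (Rel)
import Relation.Binary.PropositionalEquality as ≡
open import Relation.Nullary.Negation.Core using () renaming (¬_ to Not)

infix  9 ¬ᶠ_ ∘ᶠ_
infixr 7 _∧ᶠ_
infixr 6 _∨ᶠ_
infixr 5 _→ᶠ_
infix  4 _↔ᶠ_

data For : Set where
  var  : ℕ → For
  _∧ᶠ_ : For → For → For
  _∨ᶠ_ : For → For → For
  _→ᶠ_ : For → For → For
  ¬ᶠ_  : For → For
  ∘ᶠ_  : For → For

_↔ᶠ_ : For → For → For
α ↔ᶠ β = (α →ᶠ β) ∧ᶠ (β →ᶠ α)

i2 : For → For
i2 α = ¬ᶠ ∘ᶠ α →ᶠ ¬ᶠ α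

data RmbC-Axiom : For → Set where
  K    : ∀ α β → RmbC-Axiom (α →ᶠ (β →ᶠ α))
  S    : ∀ α β γ → RmbC-Axiom ((α →ᶠ (β →ᶠ γ)) →ᶠ ((α →ᶠ β) →ᶠ (α →ᶠ γ)))
  ∧-i  : ∀ α β → RmbC-Axiom (α →ᶠ (β →ᶠ (α ∧ᶠ β)))
  ∧-e₁ : ∀ α β → RmbC-Axiom ((α ∧ᶠ β) →ᶠ α)
  ∧-e₂ : ∀ α β → RmbC-Axiom ((α ∧ᶠ β) →ᶠ β)
  ∨-i₁ : ∀ α β → RmbC-Axiom (α →ᶠ (α ∨ᶠ β))
  ∨-i₂ : ∀ α β → RmbC-Axiom (β →ᶠ (α ∨ᶠ β))
  ∨-e  : ∀ α β γ → RmbC-Axiom ((α →ᶠ γ) →ᶠ ((β →ᶠ γ) →ᶠ ((α ∨ᶠ β) →ᶠ γ)))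
  →-∨  : ∀ α β → RmbC-Axiom ((α →ᶠ β) ∨ᶠ α)
  em   : ∀ α → RmbC-Axiom (α ∨ᶠ ¬ᶠ α)
  bc   : ∀ α β → RmbC-Axiom (∘ᶠ α →ᶠ (α →ᶠ (¬ᶠ α →ᶠ β)))

data RmbC[i2]-Axiom : For → Set where
  rmbc  : ∀ {α} → RmbC-Axiom α → RmbC[i2]-Axiom α
  ax-i2 : ∀ α → RmbC[i2]-Axiom (i2 α)

infix 3 ⊢[_]_ ⊢RmbC[i2]_

data ⊢[_]_ (Ax : For → Set) : For → Set where
  ax : ∀ {α} → Ax α → ⊢[ Ax ] α
  mp : ∀ {α β} → ⊢[ Ax ] α → ⊢[ Ax ] (α →ᶠ β) → ⊢[ Ax ] β
  R¬ : ∀ {α ψ} → ⊢[ Ax ] (α ↔ᶠ ψ) → ⊢[ Ax ] (¬ᶠ α ↔ᶠ ¬ᶠ ψ)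
  R∘ : ∀ {α ψ} → ⊢[ Ax ] (α ↔ᶠ ψ) → ⊢[ Ax ] (∘ᶠ α ↔ᶠ ∘ᶠ ψ)

⊢RmbC[i2]_ : For → Set
⊢RmbC[i2] φ = ⊢[ RmbC[i2]-Axiom ] φ

-- ¬_ is the paraconsistent negation.  The Boolean complement is not part of
-- the signature: it is the term a ⇒ 0#, and ⇒-def says that _⇒_ is the Boolean
-- implication.  Equality is a setoid equality, so ¬_ and ∘_ have to be required
-- to respect it.
record BALFI c ℓ : Set (suc (c ⊔ ℓ)) where
  infix  9 ¬_ ∘_
  infixr 7 _∧_
  infixr 6 _∨_
  infixr 5 _⇒_
  infix  4 _≈_ _≉_
  field
    Carrier          : Set c
    _≈_              : Rel Carrier ℓ
    _∧_              : Op₂ Carrier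
    _∨_              : Op₂ Carrier
    _⇒_              : Op₂ Carrier
    ¬_               : Op₁ Carrier
    ∘_               : Op₁ Carrier
    0#               : Carrier
    1#               : Carrier
    isBooleanAlgebra : IsBooleanAlgebra _≈_ _∨_ _∧_ (_⇒ 0#) 1# 0#
    ⇒-def            : ∀ a b → (a ⇒ b) ≈ ((a ⇒ 0#) ∨ b)
    ¬-cong           : Congruent₁ _≈_ ¬_
    ∘-cong           : Congruent₁ _≈_ ∘_
    a∨¬a≈1           : ∀ a → (a ∨ ¬ a) ≈ 1#
    a∧¬a∧∘a≈0        : ∀ a → (a ∧ ¬ a ∧ ∘ a) ≈ 0#

  setoid : Setoid c ℓ
  setoid = record
    { isEquivalence = IsBooleanAlgebra.isEquivalence isBooleanAlgebra }

  _≉_ : Rel Carrier ℓ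
  a ≉ b = Not (a ≈ b)

Finite : ∀ {c ℓ} → BALFI c ℓ → Set (c ⊔ ℓ)
Finite B = ∃[ n ] Inverse (BALFI.setoid B) (≡.setoid (Fin n))

record Valuation {c ℓ} (B : BALFI c ℓ) : Set (c ⊔ ℓ) where
  open BALFI B
  field
    ⟦_⟧    : For → Carrier
    ∧-homo : ∀ α β → ⟦ α ∧ᶠ β ⟧ ≈ (⟦ α ⟧ ∧ ⟦ β ⟧)
    ∨-homo : ∀ α β → ⟦ α ∨ᶠ β ⟧ ≈ (⟦ α ⟧ ∨ ⟦ β ⟧)
    →-homo : ∀ α β → ⟦ α →ᶠ β ⟧ ≈ (⟦ α ⟧ ⇒ ⟦ β ⟧)
    ¬-homo : ∀ α → ⟦ ¬ᶠ α ⟧ ≈ (¬ ⟦ α ⟧)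
    ∘-homo : ∀ α → ⟦ ∘ᶠ α ⟧ ≈ (∘ ⟦ α ⟧)

infix 3 _⊨_

_⊨_ : ∀ {c ℓ} → BALFI c ℓ → For → Set (c ⊔ ℓ)
B ⊨ φ = (v : Valuation B) → Valuation.⟦_⟧ v φ ≈ 1#
  where open BALFI B

BI[i2] : ∀ {c ℓ} → BALFI c ℓ → Set (c ⊔ ℓ)
BI[i2] B = ∀ α → B ⊨ i2 α

{-# OPTIONS --safe #-}

-- Call a formula under ¬ or ∘ in φ a negand, and treat each variable of φ and
-- each ¬ψ, ∘ψ with ψ a negand as a propositional atom.  Starting from all
-- Boolean assignments of the atoms, delete those that falsify an instance of
-- em, bc or i2, and, whenever ψ and χ agree on all the remaining assignments,
-- those separating ¬ψ from ¬χ or ∘ψ from ∘χ (and likewise those falsifying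
-- ¬χ → ¬ψ, a form of i2, whenever ∘ψ and χ agree).  At every stage a formula over
-- the atoms that holds at all remaining assignments is provable (Kalmár's
-- completeness argument at the start, R¬ and R∘ for the deletions).
--
-- When nothing more is deleted, the powerset of the surviving assignments is a
-- finite algebra: ¬ and ∘ are dictated by the atoms at the extension of a
-- negand, while any other a gets the complement for ¬ a, and ∘ a = a.  The
-- latter choice keeps i2: if ∘ψ is not the extension of a negand, then the
-- complement of ∘ψ lies below ¬ψ because ∘ψ ∨ ¬ψ is provable.
module Submission where

open import Defs
open import Level using (0ℓ)
open import Data.Product.Base using (Σ-syntax; _×_)
open import Relation.Nullary.Negation.Core using (¬_)

open import Algebra.Lattice.Structures using (IsBooleanAlgebra)
open import Data.Bool.Base using (Bool; true; false; not; _∧_; _∨_; if_then_else_)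
open import Data.Bool.Properties using () renaming (_≟_ to _≟ᵇ_)
open import Data.Fin.Base using (Fin)
open import Data.Fin.Properties using (2↔Bool; *↔×)
open import Data.Fin.Subset using (Subset; _∪_; _∩_; ∁; ⊤; ⊥)
open import Data.Fin.Subset.Properties
  using (∪-∩-isBooleanAlgebra; ∪-∩-booleanAlgebra; ∪-identityʳ)
open import Data.List.Base
  using (List; []; _∷_; _++_; [_]; length; filter; concat; cartesianProductWith)
open import Data.List.Membership.Propositional using (_∈_; find; lose)
open import Data.List.Membership.Propositional.Properties
  using (∈-filter⁺; ∈-cartesianProductWith⁺)
open import Data.List.Properties using (filter-notAll)
open import Data.List.Relation.Binary.Subset.Propositional using (_⊆_)
open import Data.List.Relation.Unary.All as All using (All; []; _∷_; all?)
open import Data.List.Relation.Unary.All.Properties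
  using (++⁺; ++⁻ˡ; ++⁻ʳ; concat⁺; concat⁻; cartesianProductWith⁺; ¬All⇒Any¬)
open import Data.List.Relation.Unary.Any using (Any; here; there; any?)
open import Data.Nat.Base using (ℕ; zero; suc; _<_; _^_)
open import Data.Nat.Induction using (<-wellFounded)
open import Data.Nat.Properties using () renaming (_≟_ to _≟ⁿ_)
open import Data.Product.Base using (∃; _,_; proj₁; proj₂; uncurry)
open import Data.Product.Function.NonDependent.Propositional using (_×-↔_)
open import Data.Sum.Base using (_⊎_; inj₁; inj₂)
open import Data.Vec.Base as Vec using (Vec; []; _∷_; fromList; zipWith)
open import Data.Vec.Properties using (map-const; map-∘; ≡-dec; ∷-injective)
open import Function.Base using (id; const; _∘_)
open import Function.Bundles using (_↔_; mk↔ₛ′; Inverse)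
open import Function.Properties.Inverse using (↔-sym; ↔-trans)
open import Induction.WellFounded using (Acc; acc)
open import Relation.Binary.Definitions using (DecidableEquality)
open import Relation.Binary.PropositionalEquality
  using (_≡_; refl; sym; trans; cong; cong₂; subst; setoid; module ≡-Reasoning)
open import Relation.Nullary.Decidable.Core
  using (Dec; does; yes; no; map′; _×-dec_; _→-dec_)
open import Relation.Nullary.Negation.Core using (contradiction)

import Algebra.Lattice.Properties.BooleanAlgebra as BooleanAlgebraProperties

private variable
  α β γ χ ψ : For
  Γ Δ as : List For

-- Decidable equality of formulas.

-- Comparing head symbols by number first leaves only the six diagonal cases to decide.
tag : For → ℕ
tag (var _)  = 0
tag (_ ∧ᶠ _) = 1
tag (_ ∨ᶠ _) = 2
tag (_ →ᶠ _) = 3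
tag (¬ᶠ _)   = 4
tag (∘ᶠ _)   = 5

_≟_ : DecidableEquality For
≟-sameTag : ∀ α β → tag α ≡ tag β → Dec (α ≡ β)

α ≟ β with tag α ≟ⁿ tag β
... | yes same = ≟-sameTag α β same
... | no  diff = no (diff ∘ cong tag)

≟-sameTag (var m)    (var n)    _ = map′ (cong var) (λ { refl → refl }) (m ≟ⁿ n)
≟-sameTag (α ∧ᶠ β) (γ ∧ᶠ δ) _ =
  map′ (uncurry (cong₂ _∧ᶠ_)) (λ { refl → refl , refl }) (α ≟ γ ×-dec β ≟ δ)
≟-sameTag (α ∨ᶠ β) (γ ∨ᶠ δ) _ =
  map′ (uncurry (cong₂ _∨ᶠ_)) (λ { refl → refl , refl }) (α ≟ γ ×-dec β ≟ δ)
≟-sameTag (α →ᶠ β) (γ →ᶠ δ) _ =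
  map′ (uncurry (cong₂ _→ᶠ_)) (λ { refl → refl , refl }) (α ≟ γ ×-dec β ≟ δ)
≟-sameTag (¬ᶠ α)     (¬ᶠ β)     _ = map′ (cong ¬ᶠ_) (λ { refl → refl }) (α ≟ β)
≟-sameTag (∘ᶠ α)     (∘ᶠ β)     _ = map′ (cong ∘ᶠ_) (λ { refl → refl }) (α ≟ β)

-- Derivability from hypotheses

infix 3 _⊩_

-- R¬ and R∘ apply to theorems only, which is what makes the deduction theorem
-- hold.
data _⊩_ (Γ : List For) : For → Set where
  hyp : α ∈ Γ → Γ ⊩ α
  thm : ⊢RmbC[i2] α → Γ ⊩ α
  app : Γ ⊩ α →ᶠ β → Γ ⊩ α → Γ ⊩ β

axiom : RmbC-Axiom α → Γ ⊩ α
axiom a = thm (ax (rmbc a))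

h₀ : α ∷ Γ ⊩ α
h₀ = hyp (here refl)

h₁ : α ∷ β ∷ Γ ⊩ β
h₁ = hyp (there (here refl))

h₂ : α ∷ β ∷ γ ∷ Γ ⊩ γ
h₂ = hyp (there (there (here refl)))

weaken : Γ ⊆ Δ → Γ ⊩ α → Δ ⊩ α
weaken Γ⊆Δ (hyp α∈Γ) = hyp (Γ⊆Δ α∈Γ)
weaken Γ⊆Δ (thm t)   = thm t
weaken Γ⊆Δ (app p q) = app (weaken Γ⊆Δ p) (weaken Γ⊆Δ q)

wk : Γ ⊩ α → β ∷ Γ ⊩ α
wk = weaken there

deduction : α ∷ Γ ⊩ β → Γ ⊩ α →ᶠ β
deduction {α} (hyp (here refl)) =
  app (app (axiom (S α (α →ᶠ α) α)) (axiom (K α (α →ᶠ α)))) (axiom (K α α))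
deduction (hyp (there β∈Γ)) = app (axiom (K _ _)) (hyp β∈Γ)
deduction (thm t)           = app (axiom (K _ _)) (thm t)
deduction (app p q)         = app (app (axiom (S _ _ _)) (deduction p)) (deduction q)

⊩⇒⊢ : [] ⊩ α → ⊢RmbC[i2] α
⊩⇒⊢ (thm t)   = t
⊩⇒⊢ (app p q) = mp (⊩⇒⊢ q) (⊩⇒⊢ p)

∧-intro : Γ ⊩ α → Γ ⊩ β → Γ ⊩ α ∧ᶠ β
∧-intro p q = app (app (axiom (∧-i _ _)) p) q

∧-elim₁ : Γ ⊩ α ∧ᶠ β → Γ ⊩ α
∧-elim₁ = app (axiom (∧-e₁ _ _))

∧-elim₂ : Γ ⊩ α ∧ᶠ β → Γ ⊩ β
∧-elim₂ = app (axiom (∧-e₂ _ _))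

∨-elim : Γ ⊩ α →ᶠ γ → Γ ⊩ β →ᶠ γ → Γ ⊩ α ∨ᶠ β → Γ ⊩ γ
∨-elim p q r = app (app (app (axiom (∨-e _ _ _)) p) q) r

-- Completeness of the Boolean assignments

Assignment : Set
Assignment = For → Bool

_[_≔_] : Assignment → For → Bool → Assignment
(w [ a ≔ b ]) x = if does (x ≟ a) then b else w x

eval : Assignment → For → Bool
eval w (α ∧ᶠ β) = eval w α ∧ eval w β
eval w (α ∨ᶠ β) = eval w α ∨ eval w β
eval w (α →ᶠ β) = not (eval w α) ∨ eval w β
eval w α        = w α

Over : List For → For → Set
Over as (α ∧ᶠ β) = Over as α × Over as β
Over as (α ∨ᶠ β) = Over as α × Over as β
Over as (α →ᶠ β) = Over as α × Over as β
Over as α        = α ∈ as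

-- The formula γ to be proved plays the role of falsum.
signed : For → Bool → For → For
signed γ true  α = (α →ᶠ γ) →ᶠ γ
signed γ false α = α →ᶠ γ

signed-∧ : ∀ b c → Γ ⊩ signed γ b α → Γ ⊩ signed γ c β → Γ ⊩ signed γ (b ∧ c) (α ∧ᶠ β)
signed-∧ false c     p q = deduction (app (wk p) (∧-elim₁ h₀))
signed-∧ true  false p q = deduction (app (wk q) (∧-elim₂ h₀))
signed-∧ true  true  p q = deduction (app (wk p) (deduction (app (wk (wk q))
  (deduction (app h₂ (∧-intro h₁ h₀))))))

signed-∨ : ∀ b c → Γ ⊩ signed γ b α → Γ ⊩ signed γ c β → Γ ⊩ signed γ (b ∨ c) (α ∨ᶠ β)
signed-∨ true  c     p q = deduction (app (wk p) (deduction (app h₁ (app (axiom (∨-i₁ _ _)) h₀))))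
signed-∨ false true  p q = deduction (app (wk q) (deduction (app h₁ (app (axiom (∨-i₂ _ _)) h₀))))
signed-∨ false false p q = app (app (axiom (∨-e _ _ _)) p) q

signed-→ : ∀ b c → Γ ⊩ signed γ b α → Γ ⊩ signed γ c β → Γ ⊩ signed γ (not b ∨ c) (α →ᶠ β)
-- The classical step: both disjuncts of `→-∨` lead to `γ`.
signed-→ false c     p q = deduction (∨-elim h₀ (wk p) (axiom (→-∨ _ _)))
signed-→ true  true  p q = deduction (app (wk q) (deduction (app h₁ (app (axiom (K _ _)) h₀))))
signed-→ true  false p q = deduction (app (wk p) (deduction (app (wk (wk q)) (app h₁ h₀))))

signed-eval : ∀ w α → Over as α → (∀ {a} → a ∈ as → Γ ⊩ signed γ (w a) a) →
              Γ ⊩ signed γ (eval w α) α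
signed-eval w (var n)  o       lit = lit o
signed-eval w (α ∧ᶠ β) (o , p) lit = signed-∧ (eval w α) _ (signed-eval w α o lit) (signed-eval w β p lit)
signed-eval w (α ∨ᶠ β) (o , p) lit = signed-∨ (eval w α) _ (signed-eval w α o lit) (signed-eval w β p lit)
signed-eval w (α →ᶠ β) (o , p) lit = signed-→ (eval w α) _ (signed-eval w α o lit) (signed-eval w β p lit)
signed-eval w (¬ᶠ α)   o       lit = lit o
signed-eval w (∘ᶠ α)   o       lit = lit o

Valid : List Assignment → For → Set
Valid W α = All (λ w → eval w α ≡ true) W

Refuted : List Assignment → For → Set
Refuted W α = All (λ w → eval w α ≡ false) W

-- The invariant of the deletions: a smaller `W` makes more formulas valid, so keeping it is a
-- stronger claim.
Sound : List For → List Assignment → Set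
Sound as W = ∀ {α} → Over as α → Valid W α → ⊢RmbC[i2] α

assignments : List For → Assignment → List Assignment
assignments []       w = [ w ]
assignments (a ∷ as) w = assignments as (w [ a ≔ true ]) ++ assignments as (w [ a ≔ false ])

-- Induction on the atoms `bs` still to be split; every other atom already has its literal
-- derivable.
assignments-derive : ∀ bs w → Over as γ →
                     (∀ {a} → a ∈ as → a ∈ bs ⊎ (Γ ⊩ signed γ (w a) a)) →
                     Valid (assignments bs w) γ → Γ ⊩ γ
assignments-derive {as} {γ} {Γ} [] w o lit (γ-true ∷ []) =
  -- As `γ` evaluates to true, its signed form is `(γ →ᶠ γ) →ᶠ γ`.
  app (subst (λ b → Γ ⊩ signed γ b γ) γ-true (signed-eval w γ o decided)) (deduction h₀)
  where
  decided : ∀ {a} → a ∈ as → Γ ⊩ signed γ (w a) a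
  decided a∈as with lit a∈as
  ... | inj₂ d = d
assignments-derive {as} {γ} {Γ} (b ∷ bs) w o lit valid =
  -- The positive literal is literally the negative one implying `γ`, so a single application merges
  -- the two cases.
  app (deduction (assignments-derive bs _ o (extend true)  (++⁻ˡ _ valid)))
      (deduction (assignments-derive bs _ o (extend false) (++⁻ʳ (assignments bs (w [ b ≔ true ])) valid)))
  where
  extend : ∀ c {a} → a ∈ as →
           a ∈ bs ⊎ (signed γ c b ∷ Γ ⊩ signed γ ((w [ b ≔ c ]) a) a)
  extend c {a} a∈as with a ≟ b | lit a∈as
  ... | yes refl | _                  = inj₂ h₀
  ... | no a≢b   | inj₁ (here a≡b)    = contradiction a≡b a≢b
  ... | no _     | inj₁ (there a∈bs)  = inj₁ a∈bs
  ... | no _     | inj₂ d             = inj₂ (wk d)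

assignments-sound : ∀ as → Sound as (assignments as (const false))
assignments-sound as o valid = ⊩⇒⊢ (assignments-derive as _ o inj₁ valid)

-- Deleting assignments

-- Since `¬ᶠ` is paraconsistent, absurdity is expressed by explosion.
Refutable : For → Set
Refutable χ = ∀ β → ⊢RmbC[i2] (χ →ᶠ β)

refuted? : ∀ χ (w : Assignment) → Dec (eval w χ ≡ false)
refuted? χ w = eval w χ ≟ᵇ false

-- If `α` holds at all survivors, then `χ ∨ᶠ α` holds on all of `W` and is provable; the disjunct
-- `χ` yields `α` by explosion.
filter-sound : ∀ {W} → Over as χ → Refutable χ → Sound as W → Sound as (filter (refuted? χ) W)
filter-sound {χ = χ} {W} oχ χ-refutable W-sound {α} oα valid =
  ⊩⇒⊢ (∨-elim (thm (χ-refutable α)) (deduction h₀) (thm (W-sound (oχ , oα) (All.tabulate χ∨α))))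
  where
  χ∨α : ∀ {w} → w ∈ W → eval w (χ ∨ᶠ α) ≡ true
  χ∨α {w} w∈W with eval w χ in eq
  ... | true  = refl
  ... | false = All.lookup valid (∈-filter⁺ (refuted? χ) w∈W eq)

-- (p , χ): if p is a theorem, then χ is refutable.
Rule : Set
Rule = For × For

Admissible : List For → Rule → Set
Admissible as (p , χ) = Over as p × Over as χ × (⊢RmbC[i2] p → Refutable χ)

Closed : List Assignment → Rule → Set
Closed W (p , χ) = Valid W p → Refuted W χ

closed? : ∀ W r → Dec (Closed W r)
closed? W (p , χ) = all? (λ w → eval w p ≟ᵇ true) W →-dec all? (refuted? χ) W

-- A rule that is not closed has a valid, hence provable, premise and a `χ` true at some assignment,
-- so deleting for `χ` strictly shortens `W`.
saturate : ∀ {rs} → All (Admissible as) rs → ∀ W → Acc _<_ (length W) → Sound as W →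
           ∃ λ W′ → Sound as W′ × All (Closed W′) rs
saturate {rs = rs} admissible W (acc smaller) W-sound with all? (closed? W) rs
... | yes closed = W , W-sound , closed
... | no ¬closed with (p , χ) , r∈rs , ¬r ← find (¬All⇒Any¬ (closed? W) rs ¬closed)
                 with all? (λ w → eval w p ≟ᵇ true) W
...   | no ¬valid = contradiction (λ valid → contradiction valid ¬valid) ¬r
...   | yes valid with op , oχ , refutable ← All.lookup admissible r∈rs =
  saturate admissible _
    (smaller (filter-notAll (refuted? χ) W (¬All⇒Any¬ (refuted? χ) W (¬r ∘ const))))
    (filter-sound {W = W} oχ (refutable (W-sound op valid)) W-sound)

-- The rules imposed on the negands

clash : For → For
clash ψ = ψ ∧ᶠ ¬ᶠ ψ ∧ᶠ ∘ᶠ ψ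

clash-refutable : ∀ ψ → Refutable (clash ψ)
clash-refutable ψ β = ⊩⇒⊢ (deduction
  (app (app (app (axiom (bc ψ β)) (∧-elim₂ (∧-elim₂ h₀))) (∧-elim₁ h₀)) (∧-elim₁ (∧-elim₂ h₀))))

-- An assignment refuting denial ψ θ satisfies θ and refutes clash ψ.
denial : For → For → For
denial ψ θ = θ →ᶠ clash ψ

denial-refutable : ∀ ψ {θ} → ⊢RmbC[i2] θ → Refutable (denial ψ θ)
denial-refutable ψ θ-thm β =
  ⊩⇒⊢ (deduction (app (thm (clash-refutable ψ β)) (app h₀ (thm θ-thm))))

-- In order: `R¬`, `R∘`, contraposed `i2`, excluded middle, and `∘ᶠ ψ ∨ᶠ ¬ᶠ ψ`. The last two have a
-- tautology as premise, so they always fire; `bc` is enforced through the `clash` inside each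
-- denial.
rules : For → For → List Rule
rules ψ χ =
    ((ψ ↔ᶠ χ)    , denial ψ (¬ᶠ ψ ↔ᶠ ¬ᶠ χ))
  ∷ ((ψ ↔ᶠ χ)    , denial ψ (∘ᶠ ψ ↔ᶠ ∘ᶠ χ))
  ∷ ((∘ᶠ ψ ↔ᶠ χ) , denial ψ (¬ᶠ χ →ᶠ ¬ᶠ ψ))
  ∷ ((ψ ↔ᶠ ψ)    , denial ψ (ψ ∨ᶠ ¬ᶠ ψ))
  ∷ ((ψ ↔ᶠ ψ)    , denial ψ (∘ᶠ ψ ∨ᶠ ¬ᶠ ψ))
  ∷ []

-- Excluded middle for `∘ᶠ ψ`, with `i2` sending `¬ᶠ ∘ᶠ ψ` to `¬ᶠ ψ`.
∘∨¬ : ∀ ψ → ⊢RmbC[i2] (∘ᶠ ψ ∨ᶠ ¬ᶠ ψ)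
∘∨¬ ψ = ⊩⇒⊢ (∨-elim (axiom (∨-i₁ _ _))
  (deduction (app (axiom (∨-i₂ _ _)) (app (thm (ax (ax-i2 ψ))) h₀)))
  (axiom (em (∘ᶠ ψ))))

¬-anti-∘ : ⊢RmbC[i2] (∘ᶠ ψ ↔ᶠ χ) → ⊢RmbC[i2] (¬ᶠ χ →ᶠ ¬ᶠ ψ)
¬-anti-∘ eq = ⊩⇒⊢ (deduction (app (thm (ax (ax-i2 _))) (app (∧-elim₂ (thm (R¬ eq))) h₀)))

record Decided (as : List For) (ψ : For) : Set where
  constructor decided
  field
    over : Over as ψ
    over-¬ : ¬ᶠ ψ ∈ as
    over-∘ : ∘ᶠ ψ ∈ as

rules-admissible : Decided as ψ → Decided as χ → All (Admissible as) (rules ψ χ)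
rules-admissible {ψ = ψ} (decided oψ n∈ c∈) (decided oχ n∈′ c∈′) =
    (↔-over oψ oχ , denial-over (↔-over n∈ n∈′) , denial-refutable ψ ∘ R¬)
  ∷ (↔-over oψ oχ , denial-over (↔-over c∈ c∈′) , denial-refutable ψ ∘ R∘)
  ∷ (↔-over c∈ oχ , denial-over (n∈′ , n∈)      , denial-refutable ψ ∘ ¬-anti-∘)
  ∷ (↔-over oψ oψ , denial-over (oψ , n∈)       , const (denial-refutable ψ (ax (rmbc (em ψ)))))
  ∷ (↔-over oψ oψ , denial-over (c∈ , n∈)       , const (denial-refutable ψ (∘∨¬ ψ)))
  ∷ []
  where
  ↔-over : ∀ {A B : Set} → A → B → (A × B) × (B × A)
  ↔-over a b = (a , b) , (b , a)
  denial-over : ∀ {A : Set} → A → A × _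
  denial-over a = a , oψ , n∈ , c∈

-- Negands and atoms of a formula.

negands : For → List For
negands (var n)  = []
negands (α ∧ᶠ β) = negands α ++ negands β
negands (α ∨ᶠ β) = negands α ++ negands β
negands (α →ᶠ β) = negands α ++ negands β
negands (¬ᶠ α)   = α ∷ negands α
negands (∘ᶠ α)   = α ∷ negands α

-- `¬ᶠ α` and `∘ᶠ α` enter together, because the rules for a negand mention both.
atoms : For → List For
atoms (var n)  = [ var n ]
atoms (α ∧ᶠ β) = atoms α ++ atoms β
atoms (α ∨ᶠ β) = atoms α ++ atoms β
atoms (α →ᶠ β) = atoms α ++ atoms β
atoms (¬ᶠ α)   = ¬ᶠ α ∷ ∘ᶠ α ∷ atoms α
atoms (∘ᶠ α)   = ¬ᶠ α ∷ ∘ᶠ α ∷ atoms α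

atoms-over : ∀ α → All (_∈ as) (atoms α) → Over as α
atoms-over (var n)  (a ∷ [])    = a
atoms-over (α ∧ᶠ β) ps          = atoms-over α (++⁻ˡ _ ps) , atoms-over β (++⁻ʳ (atoms α) ps)
atoms-over (α ∨ᶠ β) ps          = atoms-over α (++⁻ˡ _ ps) , atoms-over β (++⁻ʳ (atoms α) ps)
atoms-over (α →ᶠ β) ps          = atoms-over α (++⁻ˡ _ ps) , atoms-over β (++⁻ʳ (atoms α) ps)
atoms-over (¬ᶠ α)   (n ∷ _ ∷ _) = n
atoms-over (∘ᶠ α)   (_ ∷ c ∷ _) = c

negands-decided : ∀ α → All (_∈ as) (atoms α) → All (Decided as) (negands α)
negands-decided (var n)  ps = []
negands-decided (α ∧ᶠ β) ps =
  ++⁺ (negands-decided α (++⁻ˡ _ ps)) (negands-decided β (++⁻ʳ (atoms α) ps))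
negands-decided (α ∨ᶠ β) ps =
  ++⁺ (negands-decided α (++⁻ˡ _ ps)) (negands-decided β (++⁻ʳ (atoms α) ps))
negands-decided (α →ᶠ β) ps =
  ++⁺ (negands-decided α (++⁻ˡ _ ps)) (negands-decided β (++⁻ʳ (atoms α) ps))
negands-decided (¬ᶠ α) (n ∷ c ∷ ps) = decided (atoms-over α ps) n c ∷ negands-decided α ps
negands-decided (∘ᶠ α) (n ∷ c ∷ ps) = decided (atoms-over α ps) n c ∷ negands-decided α ps

-- The algebra of sets of assignments

module _ {a b} {A : Set a} {B : Set b} where

  map-fromList-cong : ∀ {f g : A → B} {xs} → All (λ x → f x ≡ g x) xs →
                      Vec.map f (fromList xs) ≡ Vec.map g (fromList xs)
  map-fromList-cong []       = refl
  map-fromList-cong (e ∷ es) = cong₂ _∷_ e (map-fromList-cong es)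

  map-fromList-cong⁻ : ∀ {f g : A → B} xs → Vec.map f (fromList xs) ≡ Vec.map g (fromList xs) →
                       All (λ x → f x ≡ g x) xs
  map-fromList-cong⁻ []       _  = []
  map-fromList-cong⁻ (x ∷ xs) eq with e , es ← ∷-injective eq = e ∷ map-fromList-cong⁻ xs es

zipWith-map : ∀ {a b c d} {A : Set a} {B : Set b} {C : Set c} {D : Set d}
              (_⊕_ : B → C → D) (f : A → B) (g : A → C) {n} (xs : Vec A n) →
              Vec.map (λ x → f x ⊕ g x) xs ≡ zipWith _⊕_ (Vec.map f xs) (Vec.map g xs)
zipWith-map _⊕_ f g []       = refl
zipWith-map _⊕_ f g (x ∷ xs) = cong (_ ∷_) (zipWith-map _⊕_ f g xs)

Subset↔Fin : ∀ n → Subset n ↔ Fin (2 ^ n)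
Subset↔Fin zero    =
  mk↔ₛ′ (λ _ → Fin.zero) (λ _ → []) (λ { Fin.zero → refl ; (Fin.suc ()) }) (λ { [] → refl })
Subset↔Fin (suc n) =
  ↔-trans (mk↔ₛ′ {B = Bool × Subset n} Vec.uncons (uncurry _∷_)
                 (λ _ → refl) (λ { (_ ∷ _) → refl }))
  (↔-trans (↔-sym 2↔Bool ×-↔ Subset↔Fin n) (↔-sym *↔×))

module Countermodel
  (W : List Assignment) (D : List For)
  (closed : ∀ {ψ χ} → ψ ∈ D → χ ∈ D → All (Closed W) (rules ψ χ))
  where

  n : ℕ
  n = length W

  infixr 5 _⇒_

  _⇒_ : Subset n → Subset n → Subset n
  a ⇒ b = ∁ a ∪ b

  ext : For → Subset n
  ext α = Vec.map (λ w → eval w α) (fromList W)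

  ext-∧ : ∀ α β → ext (α ∧ᶠ β) ≡ ext α ∩ ext β
  ext-∧ α β = zipWith-map _∧_ _ _ (fromList W)

  ext-∨ : ∀ α β → ext (α ∨ᶠ β) ≡ ext α ∪ ext β
  ext-∨ α β = zipWith-map _∨_ _ _ (fromList W)

  ext-→ : ∀ α β → ext (α →ᶠ β) ≡ ext α ⇒ ext β
  ext-→ α β = trans (zipWith-map _∨_ _ _ (fromList W)) (cong (_∪ ext β) (map-∘ not _ (fromList W)))

  valid⇒ext≡⊤ : ∀ α → Valid W α → ext α ≡ ⊤
  valid⇒ext≡⊤ α v = trans (map-fromList-cong v) (map-const (fromList W) true)

  ext≡⊤⇒valid : ∀ α → ext α ≡ ⊤ → Valid W α
  ext≡⊤⇒valid α eq = map-fromList-cong⁻ W (trans eq (sym (map-const (fromList W) true)))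

  refuted⇒ext≡⊥ : ∀ α → Refuted W α → ext α ≡ ⊥
  refuted⇒ext≡⊥ α r = trans (map-fromList-cong r) (map-const (fromList W) false)

  ext≡⇒valid-↔ : ∀ α β → ext α ≡ ext β → Valid W (α ↔ᶠ β)
  ext≡⇒valid-↔ α β eq = All.map (λ {w} → ↔-true (eval w α) (eval w β)) (map-fromList-cong⁻ W eq)
    where
    ↔-true : ∀ b c → b ≡ c → (not b ∨ c) ∧ (not c ∨ b) ≡ true
    ↔-true false _ refl = refl
    ↔-true true  _ refl = refl

  valid-↔⇒ext≡ : ∀ α β → Valid W (α ↔ᶠ β) → ext α ≡ ext β
  valid-↔⇒ext≡ α β v = map-fromList-cong (All.map (λ {w} → ↔-true⁻ (eval w α) (eval w β)) v)
    where
    ↔-true⁻ : ∀ b c → (not b ∨ c) ∧ (not c ∨ b) ≡ true → b ≡ c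
    ↔-true⁻ false false _ = refl
    ↔-true⁻ true  true  _ = refl

  denial-valid : ∀ ψ θ → Refuted W (denial ψ θ) → Valid W θ
  denial-valid ψ θ = All.map (λ {w} → →-false₁ (eval w θ) _)
    where
    →-false₁ : ∀ b c → not b ∨ c ≡ false → b ≡ true
    →-false₁ true _ _ = refl

  denial-clash : ∀ ψ θ → Refuted W (denial ψ θ) → Refuted W (clash ψ)
  denial-clash ψ θ = All.map (λ {w} → →-false₂ (eval w θ) _)
    where
    →-false₂ : ∀ b c → not b ∨ c ≡ false → c ≡ false
    →-false₂ true _ eq = eq

  ¬-ext-cong : ψ ∈ D → χ ∈ D → ext ψ ≡ ext χ → ext (¬ᶠ ψ) ≡ ext (¬ᶠ χ)
  ¬-ext-cong {ψ} {χ} ψ∈D χ∈D eq with r ∷ _ ← closed ψ∈D χ∈D =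
    valid-↔⇒ext≡ (¬ᶠ ψ) (¬ᶠ χ) (denial-valid ψ (¬ᶠ ψ ↔ᶠ ¬ᶠ χ) (r (ext≡⇒valid-↔ ψ χ eq)))

  ∘-ext-cong : ψ ∈ D → χ ∈ D → ext ψ ≡ ext χ → ext (∘ᶠ ψ) ≡ ext (∘ᶠ χ)
  ∘-ext-cong {ψ} {χ} ψ∈D χ∈D eq with _ ∷ r ∷ _ ← closed ψ∈D χ∈D =
    valid-↔⇒ext≡ (∘ᶠ ψ) (∘ᶠ χ) (denial-valid ψ (∘ᶠ ψ ↔ᶠ ∘ᶠ χ) (r (ext≡⇒valid-↔ ψ χ eq)))

  ¬-ext-anti-∘ : ψ ∈ D → χ ∈ D → ext (∘ᶠ ψ) ≡ ext χ → (ext (¬ᶠ χ) ⇒ ext (¬ᶠ ψ)) ≡ ⊤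
  ¬-ext-anti-∘ {ψ} {χ} ψ∈D χ∈D eq with _ ∷ _ ∷ r ∷ _ ← closed ψ∈D χ∈D =
    trans (sym (ext-→ (¬ᶠ χ) (¬ᶠ ψ)))
      (valid⇒ext≡⊤ (¬ᶠ χ →ᶠ ¬ᶠ ψ) (denial-valid ψ (¬ᶠ χ →ᶠ ¬ᶠ ψ) (r (ext≡⇒valid-↔ (∘ᶠ ψ) χ eq))))

  ext-em : ψ ∈ D → ext ψ ∪ ext (¬ᶠ ψ) ≡ ⊤
  ext-em {ψ} ψ∈D with _ ∷ _ ∷ _ ∷ r ∷ _ ← closed ψ∈D ψ∈D =
    trans (sym (ext-∨ ψ (¬ᶠ ψ)))
      (valid⇒ext≡⊤ (ψ ∨ᶠ ¬ᶠ ψ) (denial-valid ψ (ψ ∨ᶠ ¬ᶠ ψ) (r (ext≡⇒valid-↔ ψ ψ refl))))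

  ext-∘∨¬ : ψ ∈ D → ext (∘ᶠ ψ) ∪ ext (¬ᶠ ψ) ≡ ⊤
  ext-∘∨¬ {ψ} ψ∈D with _ ∷ _ ∷ _ ∷ _ ∷ r ∷ _ ← closed ψ∈D ψ∈D =
    trans (sym (ext-∨ (∘ᶠ ψ) (¬ᶠ ψ)))
      (valid⇒ext≡⊤ (∘ᶠ ψ ∨ᶠ ¬ᶠ ψ) (denial-valid ψ (∘ᶠ ψ ∨ᶠ ¬ᶠ ψ) (r (ext≡⇒valid-↔ ψ ψ refl))))

  -- Read off the excluded-middle rule: it always fires, and its denial also refutes the clash.
  ext-clash : ψ ∈ D → ext ψ ∩ (ext (¬ᶠ ψ) ∩ ext (∘ᶠ ψ)) ≡ ⊥
  ext-clash {ψ} ψ∈D with _ ∷ _ ∷ _ ∷ r ∷ _ ← closed ψ∈D ψ∈D =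
    trans (sym (trans (ext-∧ ψ (¬ᶠ ψ ∧ᶠ ∘ᶠ ψ)) (cong (ext ψ ∩_) (ext-∧ (¬ᶠ ψ) (∘ᶠ ψ)))))
      (refuted⇒ext≡⊥ (clash ψ) (denial-clash ψ (ψ ∨ᶠ ¬ᶠ ψ) (r (ext≡⇒valid-↔ ψ ψ refl))))


  -- The operations interpreting `¬ᶠ` and `∘ᶠ`.

  open IsBooleanAlgebra (∪-∩-isBooleanAlgebra n)
    using (∨-complementˡ; ∨-complementʳ; ∧-complementˡ; ∧-complementʳ; ∧-assoc; isDistributiveLattice)
  open BooleanAlgebraProperties (∪-∩-booleanAlgebra n) using (¬-involutive; ∧-zeroˡ)

  negand? : ∀ a → Dec (Any (λ ψ → a ≡ ext ψ) D)
  negand? a = any? (λ ψ → ≡-dec _≟ᵇ_ a (ext ψ)) D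

  -- The search may return any negand with extension `a`; closure under the `R¬` rule makes the
  -- value independent of that choice.
  ¬ᴬ_ : Subset n → Subset n
  ¬ᴬ a with negand? a
  ... | yes some = ext (¬ᶠ proj₁ (find some))
  ... | no  _    = ∁ a

  ∘ᴬ_ : Subset n → Subset n
  ∘ᴬ a with negand? a
  ... | yes some = ext (∘ᶠ proj₁ (find some))
  ... | no  _    = a

  -- One witness `ψ` serves both operations, as the clash law relates `ψ`, `¬ᶠ ψ` and `∘ᶠ ψ` for the
  -- same `ψ`.
  data Position (a : Subset n) : Set where
    negand : ∀ ψ → ψ ∈ D → a ≡ ext ψ → ¬ᴬ a ≡ ext (¬ᶠ ψ) → ∘ᴬ a ≡ ext (∘ᶠ ψ) → Position a
    other  : ¬ᴬ a ≡ ∁ a → ∘ᴬ a ≡ a → Position a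

  position : ∀ a → Position a
  position a with negand? a in eq
  ... | no _     = other (¬ᴬ-no eq) (∘ᴬ-no eq)
    where
    ¬ᴬ-no : ∀ {p} → negand? a ≡ no p → ¬ᴬ a ≡ ∁ a
    ¬ᴬ-no eq rewrite eq = refl
    ∘ᴬ-no : ∀ {p} → negand? a ≡ no p → ∘ᴬ a ≡ a
    ∘ᴬ-no eq rewrite eq = refl
  ... | yes some with find some in found
  ...   | ψ , ψ∈D , a≡ = negand ψ ψ∈D a≡ ¬ᴬ-yes ∘ᴬ-yes
    where
    ¬ᴬ-yes : ¬ᴬ a ≡ ext (¬ᶠ ψ)
    ¬ᴬ-yes rewrite eq | found = refl
    ∘ᴬ-yes : ∘ᴬ a ≡ ext (∘ᶠ ψ)
    ∘ᴬ-yes rewrite eq | found = refl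

  ¬ᴬ-ext : ψ ∈ D → ¬ᴬ (ext ψ) ≡ ext (¬ᶠ ψ)
  ¬ᴬ-ext {ψ} ψ∈D with negand? (ext ψ)
  ... | yes some = let _ , χ∈D , eq = find some in ¬-ext-cong χ∈D ψ∈D (sym eq)
  ... | no  none = contradiction (lose ψ∈D refl) none

  ∘ᴬ-ext : ψ ∈ D → ∘ᴬ (ext ψ) ≡ ext (∘ᶠ ψ)
  ∘ᴬ-ext {ψ} ψ∈D with negand? (ext ψ)
  ... | yes some = let _ , χ∈D , eq = find some in ∘-ext-cong χ∈D ψ∈D (sym eq)
  ... | no  none = contradiction (lose ψ∈D refl) none

  ∪-¬ᴬ : ∀ a → a ∪ ¬ᴬ a ≡ ⊤
  ∪-¬ᴬ a with position a
  ... | negand ψ ψ∈D refl ¬a _ = trans (cong (a ∪_) ¬a) (ext-em ψ∈D)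
  ... | other ¬a _             = trans (cong (a ∪_) ¬a) (∨-complementʳ a)

  ∩-¬ᴬ-∘ᴬ : ∀ a → a ∩ (¬ᴬ a ∩ ∘ᴬ a) ≡ ⊥
  ∩-¬ᴬ-∘ᴬ a with position a
  ... | negand ψ ψ∈D refl ¬a ∘a = trans (cong (a ∩_) (cong₂ _∩_ ¬a ∘a)) (ext-clash ψ∈D)
  ... | other ¬a _              = begin
    a ∩ (¬ᴬ a ∩ ∘ᴬ a)  ≡⟨ cong (λ b → a ∩ (b ∩ ∘ᴬ a)) ¬a ⟩
    a ∩ (∁ a ∩ ∘ᴬ a)   ≡⟨ ∧-assoc a (∁ a) (∘ᴬ a) ⟨
    (a ∩ ∁ a) ∩ ∘ᴬ a   ≡⟨ cong (_∩ ∘ᴬ a) (∧-complementʳ a) ⟩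
    ⊥ ∩ ∘ᴬ a           ≡⟨ ∧-zeroˡ (∘ᴬ a) ⟩
    ⊥                  ∎
    where open ≡-Reasoning

  ¬ᴬ∘ᴬ⇒¬ᴬ : ∀ a → (¬ᴬ (∘ᴬ a) ⇒ ¬ᴬ a) ≡ ⊤
  ¬ᴬ∘ᴬ⇒¬ᴬ a with position a
  ... | other _ ∘a = trans (cong (λ b → ¬ᴬ b ⇒ ¬ᴬ a) ∘a) (∨-complementˡ (¬ᴬ a))
  ... | negand ψ ψ∈D _ ¬a ∘a = trans (cong₂ (λ b c → ¬ᴬ b ⇒ c) ∘a ¬a) (¬∘ψ⇒¬ψ (position (ext (∘ᶠ ψ))))
    where
    ¬∘ψ⇒¬ψ : Position (ext (∘ᶠ ψ)) → (¬ᴬ (ext (∘ᶠ ψ)) ⇒ ext (¬ᶠ ψ)) ≡ ⊤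
    -- Here the negation of `∘ᶠ ψ` is dictated by `χ`, which is what the third rule controls.
    ¬∘ψ⇒¬ψ (negand χ χ∈D ∘ψ≡χ ¬∘ψ _) =
      trans (cong (_⇒ ext (¬ᶠ ψ)) ¬∘ψ) (¬-ext-anti-∘ ψ∈D χ∈D ∘ψ≡χ)
    ¬∘ψ⇒¬ψ (other ¬∘ψ _) =
      trans (cong (_⇒ ext (¬ᶠ ψ)) ¬∘ψ)
        (trans (cong (_∪ ext (¬ᶠ ψ)) (¬-involutive (ext (∘ᶠ ψ)))) (ext-∘∨¬ ψ∈D))

  -- A BALFI takes `a ⇒ ⊥` as complement; the complement laws for `∁` are carried over along this
  -- equation.
  ⇒⊥≡∁ : ∀ a → (a ⇒ ⊥) ≡ ∁ a
  ⇒⊥≡∁ a = ∪-identityʳ (∁ a)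

  algebra : BALFI 0ℓ 0ℓ
  algebra = record
    { Carrier = Subset n
    ; _≈_     = _≡_
    ; _∧_     = _∩_
    ; _∨_     = _∪_
    ; _⇒_     = _⇒_
    ; ¬_      = ¬ᴬ_
    ; ∘_      = ∘ᴬ_
    ; 0#      = ⊥
    ; 1#      = ⊤
    ; isBooleanAlgebra = record
      { isDistributiveLattice = isDistributiveLattice
      ; ∨-complement = (λ a → trans (cong (_∪ a) (⇒⊥≡∁ a)) (∨-complementˡ a))
                     , (λ a → trans (cong (a ∪_) (⇒⊥≡∁ a)) (∨-complementʳ a))
      ; ∧-complement = (λ a → trans (cong (_∩ a) (⇒⊥≡∁ a)) (∧-complementˡ a))
                     , (λ a → trans (cong (a ∩_) (⇒⊥≡∁ a)) (∧-complementʳ a))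
      ; ¬-cong       = cong (_⇒ ⊥)
      }
    ; ⇒-def    = λ a b → cong (_∪ b) (sym (⇒⊥≡∁ a))
    ; ¬-cong   = cong ¬ᴬ_
    ; ∘-cong   = cong ∘ᴬ_
    ; a∨¬a≈1   = ∪-¬ᴬ
    ; a∧¬a∧∘a≈0 = ∩-¬ᴬ-∘ᴬ
    }

  algebra-finite : Finite algebra
  algebra-finite = 2 ^ n , record
    { to = to ; from = from ; to-cong = to-cong ; from-cong = from-cong ; inverse = inverse }
    where open Inverse (Subset↔Fin n)

  algebra-i2 : BI[i2] algebra
  algebra-i2 α v = begin
    ⟦ i2 α ⟧                    ≡⟨ →-homo _ _ ⟩
    ⟦ ¬ᶠ ∘ᶠ α ⟧ ⇒ ⟦ ¬ᶠ α ⟧     ≡⟨ cong₂ _⇒_ (trans (¬-homo _) (cong ¬ᴬ_ (∘-homo α))) (¬-homo α) ⟩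
    ¬ᴬ (∘ᴬ ⟦ α ⟧) ⇒ ¬ᴬ ⟦ α ⟧   ≡⟨ ¬ᴬ∘ᴬ⇒¬ᴬ ⟦ α ⟧ ⟩
    ⊤                           ∎
    where
    open Valuation v
    open ≡-Reasoning

  -- The valuation and the truth lemma.

  ⟦_⟧ : For → Subset n
  ⟦ var i ⟧  = ext (var i)
  ⟦ α ∧ᶠ β ⟧ = ⟦ α ⟧ ∩ ⟦ β ⟧
  ⟦ α ∨ᶠ β ⟧ = ⟦ α ⟧ ∪ ⟦ β ⟧
  ⟦ α →ᶠ β ⟧ = ⟦ α ⟧ ⇒ ⟦ β ⟧
  ⟦ ¬ᶠ α ⟧   = ¬ᴬ ⟦ α ⟧
  ⟦ ∘ᶠ α ⟧   = ∘ᴬ ⟦ α ⟧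

  valuation : Valuation algebra
  valuation = record
    { ⟦_⟧    = ⟦_⟧
    ; ∧-homo = λ _ _ → refl
    ; ∨-homo = λ _ _ → refl
    ; →-homo = λ _ _ → refl
    ; ¬-homo = λ _ → refl
    ; ∘-homo = λ _ → refl
    }

  -- Truth lemma: every argument of `¬ᶠ` or `∘ᶠ` in `α` lies in `D`, where the operations follow the
  -- atoms.
  ⟦⟧≡ext : ∀ α → All (_∈ D) (negands α) → ⟦ α ⟧ ≡ ext α
  ⟦⟧≡ext (var i)  _  = refl
  ⟦⟧≡ext (α ∧ᶠ β) ps = trans
    (cong₂ _∩_ (⟦⟧≡ext α (++⁻ˡ _ ps)) (⟦⟧≡ext β (++⁻ʳ (negands α) ps))) (sym (ext-∧ α β))
  ⟦⟧≡ext (α ∨ᶠ β) ps = trans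
    (cong₂ _∪_ (⟦⟧≡ext α (++⁻ˡ _ ps)) (⟦⟧≡ext β (++⁻ʳ (negands α) ps))) (sym (ext-∨ α β))
  ⟦⟧≡ext (α →ᶠ β) ps = trans
    (cong₂ _⇒_ (⟦⟧≡ext α (++⁻ˡ _ ps)) (⟦⟧≡ext β (++⁻ʳ (negands α) ps))) (sym (ext-→ α β))
  ⟦⟧≡ext (¬ᶠ α) (α∈D ∷ ps) = trans (cong ¬ᴬ_ (⟦⟧≡ext α ps)) (¬ᴬ-ext α∈D)
  ⟦⟧≡ext (∘ᶠ α) (α∈D ∷ ps) = trans (cong ∘ᴬ_ (⟦⟧≡ext α ps)) (∘ᴬ-ext α∈D)

-- Finite countermodels for underivable formulas.

theorem5p8 : (φ : For) → ¬ (⊢RmbC[i2] φ) →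
    Σ[ A ∈ BALFI 0ℓ 0ℓ ] (Finite A × BI[i2] A ×
    (Σ[ v ∈ Valuation A ] BALFI._≉_ A (Valuation.⟦_⟧ v φ) (BALFI.1# A)))
theorem5p8 φ ⊬φ = algebra , algebra-finite , algebra-i2 , valuation , refutes
  where
  as∈ : All (_∈ atoms φ) (atoms φ)
  as∈ = All.tabulate id

  D : List For
  D = negands φ

  saturated : ∃ λ W → Sound (atoms φ) W × All (Closed W) (concat (cartesianProductWith rules D D))
  saturated = saturate
    (concat⁺ (cartesianProductWith⁺ (setoid For) (setoid For) rules D D
      (λ ψ∈D χ∈D → rules-admissible (All.lookup (negands-decided φ as∈) ψ∈D)
                                    (All.lookup (negands-decided φ as∈) χ∈D))))
    _ (<-wellFounded _) (assignments-sound (atoms φ))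

  W : List Assignment
  W = proj₁ saturated

  open Countermodel W D
    (λ ψ∈D χ∈D → All.lookup (concat⁻ (proj₂ (proj₂ saturated))) (∈-cartesianProductWith⁺ rules ψ∈D χ∈D))

  refutes : ¬ (⟦ φ ⟧ ≡ ⊤)
  -- Value `⊤` would make `φ` valid on `W`, hence provable by soundness. This also covers an empty
  -- `W`, where `⊤` and `⊥` coincide.
  refutes eq = ⊬φ (proj₁ (proj₂ saturated) (atoms-over φ as∈)
    (ext≡⊤⇒valid φ (trans (sym (⟦⟧≡ext φ (All.tabulate id))) eq)))
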